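{- Let $\lambda/\mu$ be a Young diagram (left-justified or shifted, possibly skew) and let $P_{\lambda/\mu}$ be the corresponding poset. If $P_{\lambda/\mu}$ is not a chain, then $P_{\lambda/\mu}$ is $1/3$-balanced.
   Context: An integer partition $\lambda=(\lambda_1,\dots,\lambda_k)$ is a weakly decreasing sequence of positive integers; it is strict if $\lambda_1>\lambda_2>\cdots>\lambda_k$. The (left-justified) diagram of $\lambda$ is the set of cells $\{(i,j):1\le i\le k,\ 1\le j\le\lambda_i\}$. For a strict partition $\lambda$, its shifted diagram is $\{(i,j):1\le i\le k,\ i\le j\le i+\lambda_i-1\}$ (row $i$ begins at the diagonal cell $(i,i)$). If $\mu=(\mu_1,\dots,\mu_l)\subseteq\lambda$ (i.e. $l\le k$ and $\mu_i\le\lambda_i$ for all $i\le l$), the skew diagram $\lambda/\mu$ is the set-theoretic difference of the diagram of $\lambda$ and the diagram of $\mu$, taken either both left-justified or both shifted (in the shifted case $\lambda,\mu$ strict); when $\mu$ is empty, $\lambda/\mu=\lambda$. The poset $P_{\lambda/\mu}$ has the cells of the diagram as elements with $(i,j)\le(i',j')$ iff $i\le i'$ and $j\le j'$. For distinct $x,y$ in a finite poset $P$, $\mathbb{P}(x\prec y)$ is the proportion of linear extensions of $P$ (total orders compatible with the partial order) in which $x$ comes before $y$; $P$ is $1/3$-balanced if there are distinct $x,y$ with $1/3\le\mathbb{P}(x\prec y)\le2/3$. -}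

module Defs where

open import Data.Nat using (ℕ; zero; suc; _+_; _*_; _≤_; _<_; _≥_; _>_; _≤ᵇ_; _≡ᵇ_)
open import Data.Bool using (Bool; true; false; _∧_; not; T)
open import Data.Product using (_×_; _,_; ∃; ∃-syntax)
open import Data.List using (List; []; _∷_; map; concatMap; filterᵇ; length; _++_)
open import Data.Bool.ListAction using (all; any)
open import Data.Sum using (_⊎_)
open import Data.List.Relation.Unary.All using (All)
open import Data.List.Relation.Unary.Linked using (Linked)
open import Data.List.Membership.Propositional using (_∈_)
open import Data.Empty using (⊥)
open import Data.Unit using (⊤)
open import Relation.Nullary using (¬_)
open import Relation.Binary.PropositionalEquality using (_≡_; _≢_)

-- A cell (i , j) : row i, column j (1-indexed).
Cell : Set
Cell = ℕ × ℕ

IsPartition : List ℕ → Set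
IsPartition l = All (λ a → 0 < a) l × Linked _≥_ l

IsStrictPartition : List ℕ → Set
IsStrictPartition l = All (λ a → 0 < a) l × Linked _>_ l

data _⊆ₚ_ : List ℕ → List ℕ → Set where
  []⊆  : ∀ {l} → [] ⊆ₚ l
  ∷⊆   : ∀ {m l ms ls} → m ≤ l → ms ⊆ₚ ls → (m ∷ ms) ⊆ₚ (l ∷ ls)

data Kind : Set where
  ordinary shifted : Kind

ValidShape : Kind → List ℕ → List ℕ → Set
ValidShape ordinary la mu = IsPartition la × IsPartition mu
ValidShape shifted  la mu = IsStrictPartition la × IsStrictPartition mu

rowCells : ℕ → ℕ → ℕ → List Cell
rowCells i s zero    = []
rowCells i s (suc n) = (i , s) ∷ rowCells i (suc s) n

rowStart : Kind → ℕ → ℕ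
rowStart ordinary i = 1
rowStart shifted  i = i

diagramFrom : Kind → ℕ → List ℕ → List Cell
diagramFrom k i []        = []
diagramFrom k i (a ∷ as) = rowCells i (rowStart k i) a ++ diagramFrom k (suc i) as

diagram : Kind → List ℕ → List Cell
diagram k l = diagramFrom k 1 l

_≡ᶜ_ : Cell → Cell → Bool
(i , j) ≡ᶜ (i' , j') = (i ≡ᵇ i') ∧ (j ≡ᵇ j')

memᵇ : Cell → List Cell → Bool
memᵇ c = any (c ≡ᶜ_)

skewDiagram : Kind → List ℕ → List ℕ → List Cell
skewDiagram k la mu = filterᵇ (λ c → not (memᵇ c (diagram k mu))) (diagram k la)

_≼_ : Cell → Cell → Set
(i , j) ≼ (i' , j') = i ≤ i' × j ≤ j'

_≼ᵇ_ : Cell → Cell → Bool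
(i , j) ≼ᵇ (i' , j') = (i ≤ᵇ i') ∧ (j ≤ᵇ j')

insertEverywhere : {A : Set} → A → List A → List (List A)
insertEverywhere x []       = (x ∷ []) ∷ []
insertEverywhere x (y ∷ ys) = (x ∷ y ∷ ys) ∷ map (y ∷_) (insertEverywhere x ys)

permutations : {A : Set} → List A → List (List A)
permutations []       = [] ∷ []
permutations (x ∷ xs) = concatMap (insertEverywhere x) (permutations xs)

compatibleᵇ : List Cell → Bool
compatibleᵇ []       = true
compatibleᵇ (x ∷ xs) = all (λ y → not ((y ≼ᵇ x) ∧ not (y ≡ᶜ x))) xs ∧ compatibleᵇ xs

-- The linear extensions of the poset on the (duplicate-free) cell list D.
linearExtensions : List Cell → List (List Cell)
linearExtensions D = filterᵇ compatibleᵇ (permutations D)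

beforeᵇ : Cell → Cell → List Cell → Bool
beforeᵇ x y []       = false
beforeᵇ x y (z ∷ zs) = if′ (z ≡ᶜ x) (memᵇ y zs) (if′ (z ≡ᶜ y) false (beforeᵇ x y zs))
  where
  if′ : Bool → Bool → Bool → Bool
  if′ true  a b = a
  if′ false a b = b

e : List Cell → ℕ
e D = length (linearExtensions D)

e≺ : List Cell → Cell → Cell → ℕ
e≺ D x y = length (filterᵇ (beforeᵇ x y) (linearExtensions D))

IsChain : List Cell → Set
IsChain D = ∀ x y → x ∈ D → y ∈ D → (x ≼ y) ⊎ (y ≼ x)

-- 1/3-balanced: distinct x, y with 1/3 ≤ P(x ≺ y) ≤ 2/3, i.e.
-- e ≤ 3·e(x≺y) and 3·e(x≺y) ≤ 2·e.
OneThirdBalanced : List Cell → Set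
OneThirdBalanced D =
  ∃[ x ] ∃[ y ] (x ∈ D × y ∈ D × x ≢ y × e D ≤ 3 * e≺ D x y × 3 * e≺ D x y ≤ 2 * e D)

{-# OPTIONS --safe #-}

-- Call incomparable a, b almost twins if they have the same strict lower set and if the elements above
-- exactly one of them form a chain, on either side. Almost twins make a poset 1/3-balanced: let
-- N be the number of linear extensions and S(c) the number of those with a before c, and assume
-- 2 S(b) ≤ N by symmetry. Along the chain b = c₀ < c₁ < … of the elements above b but not above a,
-- exchanging a and cⱼ injects {cⱼ before a before cⱼ₊₁} into {a before cⱼ}, so S(cⱼ₊₁) ≤ 2 S(cⱼ),
-- and N ≤ 2 S(c) for the last element c of the chain. Hence the first S(cⱼ) that reaches N/3 is at most 2N/3.
--
-- A skew shape is an order-convex set of cells. To find almost twins in it, visit its minimal cells p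
-- from the north-east to the south-west. As long as the cells above p but not above the next minimal
-- cell form a chain, go on; at the first p = (r , c) where this fails, the cells (r , c + 1) and
-- (r + 1 , c), or p and its predecessor, are almost twins (in the shifted case also (r , r + 2) and
-- (r + 1 , r + 1)). If it never fails, the last two minimal cells are almost twins.
module Submission where

open import Defs
open import Data.Nat using (ℕ; zero; suc; _+_; _*_; _≤_; _<_; z≤n; s≤s; z<s; s≤s⁻¹)
open import Data.Nat.Properties
open import Data.Bool using (Bool; true; false; _∧_; not; T)
open import Data.Bool.Properties using (T-≡; T-∧; T?)
open import Data.Bool.ListAction using (all)
open import Data.Empty using (⊥-elim)
open import Data.Product using (_×_; _,_; ∃; ∃-syntax; proj₁; proj₂)
open import Data.Product.Properties using (≡-dec)
open import Data.Unit using (⊤)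
open import Data.Sum using (_⊎_; inj₁; inj₂)
open import Data.List using (List; []; _∷_; map; filter; filterᵇ; length; _++_)
open import Data.List.Properties using (length-++; length-map; length-filter; map-injective; ∷-injectiveʳ)
open import Data.List.Membership.Propositional using (_∈_; _∉_)
open import Data.List.Membership.Propositional.Properties
open import Data.List.Membership.Propositional.Properties.WithK using (unique∧set⇒bag)
open import Data.List.Relation.Unary.Any as Any using (here; there)
open import Data.List.Relation.Unary.Any.Properties using (any⁺; any⁻)
open import Data.List.Relation.Unary.All as All using ([]; _∷_)
import Data.List.Relation.Unary.All.Properties as All
open import Data.List.Relation.Unary.AllPairs as AllPairs using (AllPairs; []; _∷_)
import Data.List.Relation.Unary.AllPairs.Properties as AllPairs
open import Data.List.Relation.Unary.Linked using (Linked; []; [-]; _∷_)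
open import Data.List.Relation.Unary.Unique.Propositional using (Unique)
import Data.List.Relation.Unary.Unique.Propositional.Properties as Unique
open import Data.List.Relation.Binary.Subset.Propositional using (_⊆_)
open import Data.List.Relation.Binary.Disjoint.Propositional using (Disjoint)
open import Data.List.Relation.Binary.BagAndSetEquality using (∼bag⇒↭)
open import Data.List.Relation.Binary.Permutation.Propositional using (_↭_; prep; swap; ↭-refl; ↭-sym; ↭-trans; ↭⇒↭ₛ)
open import Data.List.Relation.Binary.Permutation.Propositional.Properties using (∈-resp-↭; drop-mid; shift)
open import Data.List.Relation.Binary.Permutation.Setoid.Properties using (Unique-resp-↭)
open import Function using (_∘_; id; case_of_)
open import Function.Bundles using (mk⇔; Equivalence)
open import Relation.Nullary using (¬_; Dec; yes; no; contradiction)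
open import Relation.Nullary.Decidable using (_×-dec_; ¬?; decidable-stable)
open import Relation.Binary.PropositionalEquality using (_≡_; _≢_; refl; sym; trans; cong; cong₂; subst; setoid)
open import Relation.Binary.Definitions using (DecidableEquality; tri<; tri≈; tri>)

-- Counting in duplicate-free lists

T-not⁺ : ∀ {b} → ¬ T b → T (not b)
T-not⁺ {false} _ = _
T-not⁺ {true}  h = h _

T-not⁻ : ∀ {b} → T (not b) → ¬ T b
T-not⁻ {false} _ ()

module _ {A : Set} where

  ∈-delete : ∀ (as : List A) {x z bs} → z ∈ as ++ x ∷ bs → z ≢ x → z ∈ as ++ bs
  ∈-delete as z∈ z≢x with ∈-++⁻ as z∈
  ... | inj₁ z∈as         = ∈-++⁺ˡ z∈as
  ... | inj₂ (here z≡x)   = contradiction z≡x z≢x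
  ... | inj₂ (there z∈bs) = ∈-++⁺ʳ as z∈bs

  length-⊆ : {xs ys : List A} → Unique xs → xs ⊆ ys → length xs ≤ length ys
  length-⊆ [] _ = z≤n
  length-⊆ {x ∷ xs} (x∉ ∷ uxs) sub with ∈-∃++ (sub (here refl))
  ... | as , bs , refl = ≤-trans
    (s≤s (length-⊆ uxs λ z∈ → ∈-delete as (sub (there z∈)) λ z≡x → All.lookup x∉ z∈ (sym z≡x)))
    (≤-reflexive (trans (cong suc (length-++ as))
      (trans (sym (+-suc (length as) (length bs))) (sym (length-++ as)))))

  ∈-filterᵇ⁻ : (p : A → Bool) (xs : List A) {x : A} → x ∈ filterᵇ p xs → x ∈ xs × T (p x)
  ∈-filterᵇ⁻ p xs = ∈-filter⁻ (T? ∘ p) {xs = xs}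

  ∈-filterᵇ⁺ : (p : A → Bool) {x : A} {xs : List A} → x ∈ xs → T (p x) → x ∈ filterᵇ p xs
  ∈-filterᵇ⁺ p = ∈-filter⁺ (T? ∘ p)

  filterᵇ-unique : (p : A → Bool) {xs : List A} → Unique xs → Unique (filterᵇ p xs)
  filterᵇ-unique p = Unique.filter⁺ (T? ∘ p)

  -- The elements satisfying `p` split into those satisfying `q` and the rest, which `f` injects
  -- into those satisfying `q`.
  count-≤-double : (L : List A) → Unique L → (p q : A → Bool) (f : A → A) →
    (∀ {w w′} → f w ≡ f w′ → w ≡ w′) →
    (∀ {w} → w ∈ L → T (p w) → ¬ T (q w) → f w ∈ L × T (q (f w))) →
    length (filterᵇ p L) ≤ length (filterᵇ q L) + length (filterᵇ q L)
  count-≤-double L uL p q f f-inj into = begin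
    length (filterᵇ p L)                               ≤⟨ length-⊆ (filterᵇ-unique p uL) split ⟩
    length (filterᵇ q L ++ filterᵇ r L)                ≡⟨ length-++ (filterᵇ q L) ⟩
    length (filterᵇ q L) + length (filterᵇ r L)        ≡⟨ cong (length (filterᵇ q L) +_) (sym (length-map f (filterᵇ r L))) ⟩
    length (filterᵇ q L) + length (map f (filterᵇ r L)) ≤⟨ +-monoʳ-≤ (length (filterᵇ q L)) moved ⟩
    length (filterᵇ q L) + length (filterᵇ q L)        ∎
    where
    open ≤-Reasoning
    r : A → Bool
    r w = p w ∧ not (q w)
    split : filterᵇ p L ⊆ filterᵇ q L ++ filterᵇ r L
    split {w} w∈ with ∈-filterᵇ⁻ p L w∈ | T? (q w)
    ... | w∈L , pw | yes qw = ∈-++⁺ˡ (∈-filterᵇ⁺ q w∈L qw)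
    ... | w∈L , pw | no ¬qw = ∈-++⁺ʳ (filterᵇ q L) (∈-filterᵇ⁺ r w∈L
        (Equivalence.from T-∧ (pw , T-not⁺ ¬qw)))
    moved : length (map f (filterᵇ r L)) ≤ length (filterᵇ q L)
    moved = length-⊆ (Unique.map⁺ f-inj (filterᵇ-unique r uL)) λ z∈ → image (∈-map⁻ f z∈)
      where
      image : ∀ {z} → ∃ (λ w → w ∈ filterᵇ r L × z ≡ f w) → z ∈ filterᵇ q L
      image (w , w∈ , refl) with ∈-filterᵇ⁻ r L w∈
      ... | w∈L , rw with Equivalence.to T-∧ rw
      ... | pw , ¬qw with into w∈L pw (T-not⁻ ¬qw)
      ... | fw∈ , qfw = ∈-filterᵇ⁺ q fw∈ qfw

  count-disjoint : (L : List A) → Unique L → (p q : A → Bool) →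
    (∀ {w} → w ∈ L → T (p w) → ¬ T (q w)) →
    length (filterᵇ p L) + length (filterᵇ q L) ≤ length L
  count-disjoint L uL p q excl = ≤-trans (≤-reflexive (sym (length-++ (filterᵇ p L))))
    (length-⊆ (Unique.++⁺ (filterᵇ-unique p uL) (filterᵇ-unique q uL) disj) sub)
    where
    disj : Disjoint (filterᵇ p L) (filterᵇ q L)
    disj (w∈p , w∈q) with ∈-filterᵇ⁻ p L w∈p
    ... | w∈L , pw = excl w∈L pw (proj₂ (∈-filterᵇ⁻ q L w∈q))
    sub : filterᵇ p L ++ filterᵇ q L ⊆ L
    sub w∈ with ∈-++⁻ (filterᵇ p L) w∈
    ... | inj₁ w∈p = proj₁ (∈-filterᵇ⁻ p L w∈p)
    ... | inj₂ w∈q = proj₁ (∈-filterᵇ⁻ q L w∈q)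

-- Permutations

  insertEverywhere-↭ : ∀ {x : A} ys {w} → w ∈ insertEverywhere x ys → w ↭ x ∷ ys
  insertEverywhere-↭ []       (here refl) = ↭-refl
  insertEverywhere-↭ (y ∷ ys) (here refl) = ↭-refl
  insertEverywhere-↭ (y ∷ ys) (there w∈) with ∈-map⁻ (y ∷_) w∈
  ... | v , v∈ , refl = ↭-trans (prep y (insertEverywhere-↭ ys v∈)) (swap _ _ ↭-refl)

  ∈-insertEverywhere : ∀ (x : A) as bs → as ++ x ∷ bs ∈ insertEverywhere x (as ++ bs)
  ∈-insertEverywhere x []       []       = here refl
  ∈-insertEverywhere x []       (b ∷ bs) = here refl
  ∈-insertEverywhere x (a ∷ as) bs       = there (∈-map⁺ (a ∷_) (∈-insertEverywhere x as bs))

  ∈-permutations⁻ : ∀ (xs : List A) {w} → w ∈ permutations xs → w ↭ xs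
  ∈-permutations⁻ []       (here refl) = ↭-refl
  ∈-permutations⁻ (x ∷ xs) w∈
    with ∈-concat⁻′ (map (insertEverywhere x) (permutations xs)) w∈
  ... | _ , w∈v , v∈ with ∈-map⁻ (insertEverywhere x) v∈
  ... | v , v∈p , refl = ↭-trans (insertEverywhere-↭ v w∈v) (prep x (∈-permutations⁻ xs v∈p))

  ∈-permutations⁺ : ∀ (xs : List A) {w} → w ↭ xs → w ∈ permutations xs
  ∈-permutations⁺ [] {[]}    p = here refl
  ∈-permutations⁺ [] {_ ∷ _} p with ∈-resp-↭ p (here refl)
  ... | ()
  ∈-permutations⁺ (x ∷ xs) p with ∈-∃++ (∈-resp-↭ (↭-sym p) (here refl))
  ... | as , bs , refl = ∈-concat⁺′ (∈-insertEverywhere x as bs)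
    (∈-map⁺ (insertEverywhere x) (∈-permutations⁺ xs (drop-mid as [] p)))

  insertEverywhere-unique : ∀ {x : A} ys → x ∉ ys → Unique (insertEverywhere x ys)
  insertEverywhere-unique []       x∉ = [] ∷ []
  insertEverywhere-unique (y ∷ ys) x∉ =
    All.map⁺ (All.tabulate λ _ → λ { refl → x∉ (here refl) })
    ∷ Unique.map⁺ ∷-injectiveʳ (insertEverywhere-unique ys (x∉ ∘ there))

  -- Deleting `x` from `w` recovers the list it was inserted into, since `x` occurs in neither list.
  -- Hence the blocks concatenated by `permutations` are disjoint.
  insertEverywhere-injective : ∀ {x : A} ys zs {w} → x ∉ ys → x ∉ zs →
    w ∈ insertEverywhere x ys → w ∈ insertEverywhere x zs → ys ≡ zs
  insertEverywhere-injective [] [] _ _ _ _ = refl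
  insertEverywhere-injective [] (z ∷ zs) _ x∉ (here refl) (there w∈) with ∈-map⁻ (z ∷_) w∈
  ... | _ , _ , refl = contradiction (here refl) x∉
  insertEverywhere-injective (y ∷ ys) [] x∉ _ (there w∈) (here refl) with ∈-map⁻ (y ∷_) w∈
  ... | _ , _ , refl = contradiction (here refl) x∉
  insertEverywhere-injective (y ∷ ys) (z ∷ zs) x∉ys x∉zs (here refl) (here refl) = refl
  insertEverywhere-injective (y ∷ ys) (z ∷ zs) x∉ys x∉zs (here refl) (there w∈) with ∈-map⁻ (z ∷_) w∈
  ... | _ , _ , refl = contradiction (here refl) x∉zs
  insertEverywhere-injective (y ∷ ys) (z ∷ zs) x∉ys x∉zs (there w∈) (here refl) with ∈-map⁻ (y ∷_) w∈
  ... | _ , _ , refl = contradiction (here refl) x∉ys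
  insertEverywhere-injective (y ∷ ys) (z ∷ zs) x∉ys x∉zs (there w∈) (there w∈′)
    with ∈-map⁻ (y ∷_) w∈ | ∈-map⁻ (z ∷_) w∈′
  ... | v , v∈ , refl | .v , v∈′ , refl =
    cong (y ∷_) (insertEverywhere-injective ys zs (x∉ys ∘ there) (x∉zs ∘ there) v∈ v∈′)

  permutations-unique : {xs : List A} → Unique xs → Unique (permutations xs)
  permutations-unique []                 = [] ∷ []
  permutations-unique {x ∷ xs} (x∉ ∷ uxs) = Unique.concat⁺
    (All.map⁺ (All.tabulate λ {v} v∈ → insertEverywhere-unique v (x∉perm v∈)))
    (AllPairs.map⁺ (disjoint (permutations xs) id (permutations-unique uxs)))
    where
    x∉perm : ∀ {v} → v ∈ permutations xs → x ∉ v
    x∉perm v∈ x∈v = All.lookup x∉ (∈-resp-↭ (∈-permutations⁻ xs v∈) x∈v) refl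
    disjoint : ∀ vs → vs ⊆ permutations xs → Unique vs →
      AllPairs (λ u v → Disjoint (insertEverywhere x u) (insertEverywhere x v)) vs
    disjoint []       _   []        = []
    disjoint (v ∷ vs) sub (v∉ ∷ uvs) =
      All.tabulate (λ {u} u∈ (w∈v , w∈u) → All.lookup v∉ u∈
        (insertEverywhere-injective v u (x∉perm (sub (here refl))) (x∉perm (sub (there u∈))) w∈v w∈u))
      ∷ disjoint vs (sub ∘ there) uvs

  unique-set-↭ : {xs ys : List A} → Unique xs → Unique ys → xs ⊆ ys → ys ⊆ xs → xs ↭ ys
  unique-set-↭ uxs uys xs⊆ys ys⊆xs = ∼bag⇒↭ (unique∧set⇒bag uxs uys (mk⇔ xs⊆ys ys⊆xs))

-- Linear extensions

_≟ᶜ_ : DecidableEquality Cell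
_≟ᶜ_ = ≡-dec _≟_ _≟_

≡ᶜ⇒≡ : ∀ {x y} → T (x ≡ᶜ y) → x ≡ y
≡ᶜ⇒≡ {i , j} {i′ , j′} t with Equivalence.to T-∧ t
... | ti , tj = cong₂ _,_ (≡ᵇ⇒≡ i i′ ti) (≡ᵇ⇒≡ j j′ tj)

≡⇒≡ᶜ : ∀ {x y} → x ≡ y → T (x ≡ᶜ y)
≡⇒≡ᶜ {i , j} refl = Equivalence.from T-∧ (≡⇒≡ᵇ i i refl , ≡⇒≡ᵇ j j refl)

memᵇ⁺ : ∀ {c xs} → c ∈ xs → T (memᵇ c xs)
memᵇ⁺ {c} = any⁺ (c ≡ᶜ_) ∘ Any.map ≡⇒≡ᶜ

memᵇ⁻ : ∀ {c xs} → T (memᵇ c xs) → c ∈ xs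
memᵇ⁻ {c} {xs} = Any.map ≡ᶜ⇒≡ ∘ any⁻ (c ≡ᶜ_) xs

_≺_ : Cell → Cell → Set
x ≺ y = x ≼ y × x ≢ y

≼-refl : ∀ {x} → x ≼ x
≼-refl = ≤-refl , ≤-refl

≼-trans : ∀ {x y z} → x ≼ y → y ≼ z → x ≼ z
≼-trans (p , q) (p′ , q′) = ≤-trans p p′ , ≤-trans q q′

≼-antisym : ∀ {x y} → x ≼ y → y ≼ x → x ≡ y
≼-antisym (p , q) (p′ , q′) = cong₂ _,_ (≤-antisym p p′) (≤-antisym q q′)

_≼?_ : ∀ x y → Dec (x ≼ y)
(i , j) ≼? (i′ , j′) = (i ≤? i′) ×-dec (j ≤? j′)

all⁺ : {A : Set} (p : A → Bool) → ∀ xs → (∀ {x} → x ∈ xs → T (p x)) → T (all p xs)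
all⁺ p []       h = _
all⁺ p (x ∷ xs) h = Equivalence.from T-∧ (h (here refl) , all⁺ p xs (h ∘ there))

all⁻ : {A : Set} (p : A → Bool) → ∀ xs → T (all p xs) → ∀ {x} → x ∈ xs → T (p x)
all⁻ p (x ∷ xs) t (here refl) = proj₁ (Equivalence.to T-∧ t)
all⁻ p (x ∷ xs) t (there y∈)  = all⁻ p xs (proj₂ (Equivalence.to (T-∧ {p x}) t)) y∈

-- Inductive counterpart of `beforeᵇ`. It passes through `map` without side conditions and follows
-- from `beforeᵇ`; the converse takes a duplicate-free list.
data Before (x y : Cell) : List Cell → Set where
  here  : ∀ {zs} → y ∈ zs → Before x y (x ∷ zs)
  there : ∀ {z zs} → Before x y zs → Before x y (z ∷ zs)

Before-∈ˡ : ∀ {x y w} → Before x y w → x ∈ w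
Before-∈ˡ (here _)  = here refl
Before-∈ˡ (there b) = there (Before-∈ˡ b)

Before-∈ʳ : ∀ {x y w} → Before x y w → y ∈ w
Before-∈ʳ (here y∈) = there y∈
Before-∈ʳ (there b) = there (Before-∈ʳ b)

Before-trans : ∀ {x y z w} → Unique w → Before x y w → Before y z w → Before x z w
Before-trans (x∉ ∷ _)  (here y∈) (here _)   = ⊥-elim (All.lookup x∉ y∈ refl)
Before-trans _         (here y∈) (there b′) = here (Before-∈ʳ b′)
Before-trans (y∉ ∷ _)  (there b) (here _)   = ⊥-elim (All.lookup y∉ (Before-∈ʳ b) refl)
Before-trans (_ ∷ uw)  (there b) (there b′) = there (Before-trans uw b b′)

Before-irrefl : ∀ {x w} → Unique w → ¬ Before x x w
Before-irrefl (x∉ ∷ _) (here x∈) = All.lookup x∉ x∈ refl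
Before-irrefl (_ ∷ uw) (there b) = Before-irrefl uw b

Before-asym : ∀ {x y w} → Unique w → Before x y w → ¬ Before y x w
Before-asym uw b b′ = Before-irrefl uw (Before-trans uw b b′)

Before-total : ∀ {x y w} → x ∈ w → y ∈ w → x ≢ y → Before x y w ⊎ Before y x w
Before-total (here refl) (here refl) x≢y = contradiction refl x≢y
Before-total (here refl) (there y∈)  _   = inj₁ (here y∈)
Before-total (there x∈)  (here refl) _   = inj₂ (here x∈)
Before-total (there x∈)  (there y∈)  x≢y with Before-total x∈ y∈ x≢y
... | inj₁ b = inj₁ (there b)
... | inj₂ b = inj₂ (there b)

Before-map⁺ : ∀ (f : Cell → Cell) {x y w} → Before x y w → Before (f x) (f y) (map f w)
Before-map⁺ f (here y∈) = here (∈-map⁺ f y∈)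
Before-map⁺ f (there b) = there (Before-map⁺ f b)

Before-map⁻ : ∀ (f : Cell → Cell) {x′ y′} w → Before x′ y′ (map f w) →
  ∃[ x ] ∃[ y ] (Before x y w × f x ≡ x′ × f y ≡ y′)
Before-map⁻ f (z ∷ w) (here y∈) with ∈-map⁻ f y∈
... | y , y∈w , refl = z , y , here y∈w , refl , refl
Before-map⁻ f (z ∷ w) (there b) with Before-map⁻ f w b
... | x , y , b′ , eq , eq′ = x , y , there b′ , eq , eq′

beforeᵇ⁺ : ∀ {x y w} → Unique w → Before x y w → T (beforeᵇ x y w)
beforeᵇ⁺ {x} _ (here y∈) with x ≡ᶜ x in eq
... | true  = memᵇ⁺ y∈
... | false = ⊥-elim (subst T eq (≡⇒≡ᶜ {x} refl))
beforeᵇ⁺ {x} {y} (z∉ ∷ uw) (there {z} b) with z ≡ᶜ x in eq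
... | true  = ⊥-elim (All.lookup z∉ (Before-∈ˡ b) (≡ᶜ⇒≡ (Equivalence.from T-≡ eq)))
... | false with z ≡ᶜ y in eq′
...   | true  = ⊥-elim (All.lookup z∉ (Before-∈ʳ b) (≡ᶜ⇒≡ (Equivalence.from T-≡ eq′)))
...   | false = beforeᵇ⁺ uw b

beforeᵇ⁻ : ∀ {x y} w → T (beforeᵇ x y w) → Before x y w
beforeᵇ⁻ {x} {y} (z ∷ w) t with z ≡ᶜ x in eq
... | true with refl ← ≡ᶜ⇒≡ {z} {x} (Equivalence.from T-≡ eq) = here (memᵇ⁻ t)
... | false with z ≡ᶜ y
...   | false = there (beforeᵇ⁻ w t)

Compatible : List Cell → Set
Compatible w = ∀ {x y} → Before x y w → ¬ y ≺ x

≼ᵇ⇒≼ : ∀ {x y} → T (x ≼ᵇ y) → x ≼ y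
≼ᵇ⇒≼ {i , j} {i′ , j′} t with Equivalence.to T-∧ t
... | ti , tj = ≤ᵇ⇒≤ i i′ ti , ≤ᵇ⇒≤ j j′ tj

≼⇒≼ᵇ : ∀ {x y} → x ≼ y → T (x ≼ᵇ y)
≼⇒≼ᵇ (p , q) = Equivalence.from T-∧ (≤⇒≤ᵇ p , ≤⇒≤ᵇ q)

compatible⁻ : ∀ w → T (compatibleᵇ w) → Compatible w
compatible⁻ (x ∷ w) t (here y∈) (y≼x , y≢x) =
  T-not⁻ (all⁻ (λ y → not ((y ≼ᵇ x) ∧ not (y ≡ᶜ x))) w (proj₁ (Equivalence.to T-∧ t)) y∈)
    (Equivalence.from T-∧ (≼⇒≼ᵇ y≼x , T-not⁺ (y≢x ∘ ≡ᶜ⇒≡)))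
compatible⁻ (x ∷ w) t (there b) =
  compatible⁻ w (proj₂ (Equivalence.to (T-∧ {all _ w}) t)) b

compatible⁺ : ∀ w → Compatible w → T (compatibleᵇ w)
compatible⁺ []      _ = _
compatible⁺ (x ∷ w) h = Equivalence.from T-∧
  ( all⁺ _ w (λ {y} y∈ → T-not⁺ λ t → let t₁ , t₂ = Equivalence.to T-∧ t in
      h (here y∈) (≼ᵇ⇒≼ t₁ , T-not⁻ t₂ ∘ ≡⇒≡ᶜ {y} {x}))
  , compatible⁺ w (h ∘ there))

module _ {D : List Cell} (uD : Unique D) where

  record LinExt (w : List Cell) : Set where
    constructor linExt
    field
      perm   : w ↭ D
      compat : Compatible w

    unique : Unique w
    unique = Unique-resp-↭ (setoid Cell) (↭⇒↭ₛ (↭-sym perm)) uD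

    ordered : ∀ {x y} → x ∈ D → y ∈ D → x ≺ y → Before x y w
    ordered x∈ y∈ x≺y with Before-total (∈-resp-↭ (↭-sym perm) x∈) (∈-resp-↭ (↭-sym perm) y∈) (proj₂ x≺y)
    ... | inj₁ b = b
    ... | inj₂ b = contradiction x≺y (compat b)

  ∈-linearExtensions⁻ : ∀ {w} → w ∈ linearExtensions D → LinExt w
  ∈-linearExtensions⁻ {w} w∈ with ∈-filterᵇ⁻ compatibleᵇ (permutations D) w∈
  ... | w∈p , t = linExt (∈-permutations⁻ D w∈p) (compatible⁻ w t)

  ∈-linearExtensions⁺ : ∀ {w} → LinExt w → w ∈ linearExtensions D
  ∈-linearExtensions⁺ {w} (linExt p c) =
    ∈-filterᵇ⁺ compatibleᵇ (∈-permutations⁺ D p) (compatible⁺ w c)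

  linearExtensions-unique : Unique (linearExtensions D)
  linearExtensions-unique = filterᵇ-unique compatibleᵇ (permutations-unique uD)

-- Almost twin pairs

transpose : Cell → Cell → Cell → Cell
transpose a c z with z ≟ᶜ a | z ≟ᶜ c
... | yes _ | _     = c
... | no _  | yes _ = a
... | no _  | no _  = z

transpose-left : ∀ a c → transpose a c a ≡ c
transpose-left a c with a ≟ᶜ a | a ≟ᶜ c
... | yes _ | _ = refl
... | no n  | _ = contradiction refl n

transpose-right : ∀ a c → transpose a c c ≡ a
transpose-right a c with c ≟ᶜ a | c ≟ᶜ c
... | yes c≡a | _     = c≡a
... | no _    | yes _ = refl
... | no _    | no n  = contradiction refl n

transpose-other : ∀ a c {z} → z ≢ a → z ≢ c → transpose a c z ≡ z
transpose-other a c {z} z≢a z≢c with z ≟ᶜ a | z ≟ᶜ c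
... | yes z≡a | _       = contradiction z≡a z≢a
... | no _    | yes z≡c = contradiction z≡c z≢c
... | no _    | no _    = refl

transpose-involutive : ∀ a c z → transpose a c (transpose a c z) ≡ z
transpose-involutive a c z with z ≟ᶜ a | z ≟ᶜ c
... | yes refl | _        = transpose-right a c
... | no _     | yes refl = transpose-left a c
... | no z≢a   | no z≢c   = transpose-other a c z≢a z≢c

transpose-injective : ∀ a c {y z} → transpose a c y ≡ transpose a c z → y ≡ z
transpose-injective a c {y} {z} eq = trans (sym (transpose-involutive a c y))
  (trans (cong (transpose a c) eq) (transpose-involutive a c z))

transpose-∈ : ∀ {D} a c {z} → a ∈ D → c ∈ D → z ∈ D → transpose a c z ∈ D
transpose-∈ a c {z} a∈ c∈ z∈ with z ≟ᶜ a | z ≟ᶜ c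
... | yes _ | _     = c∈
... | no _  | yes _ = a∈
... | no _  | no _  = z∈

map-transpose-injective : ∀ a c {w w′} → map (transpose a c) w ≡ map (transpose a c) w′ → w ≡ w′
map-transpose-injective a c = map-injective (transpose-injective a c)

-- Enumerates in increasing order the elements above c but not above a.
data Ladder (D : List Cell) (a : Cell) : Cell → Set where
  top  : ∀ {c} → (∀ {v} → v ∈ D → c ≺ v → a ≼ v) → Ladder D a c
  step : ∀ {c c⁺} → c⁺ ∈ D → c ≼ c⁺ → ¬ a ≼ c⁺ →
         (∀ {v} → v ∈ D → c ≺ v → ¬ a ≼ v → c⁺ ≼ v) → Ladder D a c⁺ → Ladder D a c

ChainAbove : List Cell → Cell → Cell → Set
ChainAbove D b a = ∀ {u v} → u ∈ D → v ∈ D → b ≼ u → b ≼ v → ¬ a ≼ u → ¬ a ≼ v → u ≼ v ⊎ v ≼ u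

-- The reading order, row by row. It extends `≼` linearly, so the `lexMin` of a list of cells is
-- also `≼`-minimal in it.
_≤ₗ_ : Cell → Cell → Set
(i , j) ≤ₗ (i′ , j′) = i < i′ ⊎ (i ≡ i′ × j ≤ j′)

≤ₗ-refl : ∀ {x} → x ≤ₗ x
≤ₗ-refl = inj₂ (refl , ≤-refl)

≤ₗ-trans : ∀ {x y z} → x ≤ₗ y → y ≤ₗ z → x ≤ₗ z
≤ₗ-trans (inj₁ p)          (inj₁ q)          = inj₁ (<-trans p q)
≤ₗ-trans (inj₁ p)          (inj₂ (refl , _)) = inj₁ p
≤ₗ-trans (inj₂ (refl , _)) (inj₁ q)          = inj₁ q
≤ₗ-trans (inj₂ (refl , p)) (inj₂ (refl , q)) = inj₂ (refl , ≤-trans p q)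

≤ₗ-total : ∀ x y → x ≤ₗ y ⊎ y ≤ₗ x
≤ₗ-total (i , j) (i′ , j′) with <-cmp i i′
... | tri< i<i′ _ _ = inj₁ (inj₁ i<i′)
... | tri> _ _ i′<i = inj₂ (inj₁ i′<i)
... | tri≈ _ refl _ with ≤-total j j′
...   | inj₁ p = inj₁ (inj₂ (refl , p))
...   | inj₂ p = inj₂ (inj₂ (refl , p))

≼-≤ₗ-antisym : ∀ {x y} → y ≼ x → x ≤ₗ y → x ≡ y
≼-≤ₗ-antisym (p , q) (inj₁ i<)         = contradiction i< (≤⇒≯ p)
≼-≤ₗ-antisym (p , q) (inj₂ (refl , j≤)) = cong (_ ,_) (≤-antisym j≤ q)

lexMin : ∀ x xs → ∃[ m ] (m ∈ x ∷ xs × (∀ {v} → v ∈ x ∷ xs → m ≤ₗ v))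
lexMin x []       = x , here refl , λ { (here refl) → ≤ₗ-refl }
lexMin x (y ∷ ys) with lexMin y ys
... | m , m∈ , min with ≤ₗ-total x m
...   | inj₁ x≤m = x , here refl , λ { (here refl) → ≤ₗ-refl ; (there v∈) → ≤ₗ-trans x≤m (min v∈) }
...   | inj₂ m≤x = m , there m∈ , λ { (here refl) → m≤x ; (there v∈) → min v∈ }

-- The reading-order minimum of the cells above `c` and not above `a` is `≼`-minimal, and the chain
-- condition turns minimal into least: this is the next rung. The number of cells left, bounded by
-- `n`, drops each time.
chain⇒ladder : ∀ {D a b} → Unique D → ChainAbove D b a → Ladder D a b
chain⇒ladder {D} {a} {b} uD chain = go (length D) b ≼-refl (length-filter (above? b) D)
  where
  above? : ∀ c v → Dec (c ≺ v × ¬ a ≼ v)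
  above? c v = ((c ≼? v) ×-dec ¬? (c ≟ᶜ v)) ×-dec ¬? (a ≼? v)
  above : Cell → List Cell
  above c = filter (above? c) D
  go : ∀ n c → b ≼ c → length (above c) ≤ n → Ladder D a c
  go n c b≼c bound with above c in eq
  ... | [] = top λ {v} v∈ c≺v → decidable-stable (a ≼? v) λ a⋠v →
        case subst (v ∈_) eq (∈-filter⁺ (above? c) v∈ (c≺v , a⋠v)) of λ ()
  go (suc n) c b≼c (s≤s bound) | x ∷ xs with lexMin x xs
  ... | m , m∈ , min with ∈-filter⁻ (above? c) {xs = D} (subst (m ∈_) (sym eq) m∈)
  ...   | m∈D , c≺m , a⋠m = step m∈D (proj₁ c≺m) a⋠m least
          (go n m (≼-trans b≼c (proj₁ c≺m)) (≤-trans (s≤s⁻¹ shorter) bound))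
    where
    least : ∀ {v} → v ∈ D → c ≺ v → ¬ a ≼ v → m ≼ v
    least {v} v∈ c≺v a⋠v with chain m∈D v∈ (≼-trans b≼c (proj₁ c≺m)) (≼-trans b≼c (proj₁ c≺v)) a⋠m a⋠v
    ... | inj₁ m≼v = m≼v
    ... | inj₂ v≼m with ≼-≤ₗ-antisym v≼m (min (subst (v ∈_) eq (∈-filter⁺ (above? c) v∈ (c≺v , a⋠v))))
    ...   | refl = ≼-refl
    -- `m` belongs to `above c` but not to `above m`.
    shorter : length (m ∷ above m) ≤ length (x ∷ xs)
    shorter = length-⊆
      (All.tabulate (λ v∈ m≡v → proj₂ (proj₁ (proj₂ (∈-filter⁻ (above? m) {xs = D} v∈))) m≡v)
        ∷ Unique.filter⁺ (above? m) uD)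
      λ { (here refl) → m∈
        ; (there v∈) → let v∈D , (m≼v , m≢v) , a⋠v = ∈-filter⁻ (above? m) {xs = D} v∈ in
            subst (_ ∈_) eq (∈-filter⁺ (above? c) v∈D
              ((≼-trans (proj₁ c≺m) m≼v , λ { refl → m≢v (≼-antisym m≼v (proj₁ c≺m)) }) , a⋠v)) }

module _ {D : List Cell} (uD : Unique D) where

  private
    L : List (List Cell)
    L = linearExtensions D

  -- No element of a linear extension strictly between c and a is above c or below a, so exchanging the two is harmless.
  exchange : ∀ {a c w} → a ∈ D → c ∈ D → ¬ a ≼ c → ¬ c ≼ a →
    (∀ {u} → u ∈ D → u ≺ a → u ≺ c) →
    (∀ {v} → v ∈ D → c ≺ v → ¬ a ≼ v → Before a v w) →
    Before c a w → LinExt uD w →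
    LinExt uD (map (transpose a c) w) × Before a c (map (transpose a c) w)
  exchange {a} {c} {w} a∈ c∈ a⋠c c⋠a down up c<a le = linExt perm′ compat′ , a<c
    where
    open LinExt le
    τ : Cell → Cell
    τ = transpose a c
    perm′ : map τ w ↭ D
    perm′ = unique-set-↭ (Unique.map⁺ (transpose-injective a c) unique) uD
      (λ z∈ → let y , y∈ , eq = ∈-map⁻ τ z∈ in
        subst (_∈ D) (sym eq) (transpose-∈ a c a∈ c∈ (∈-resp-↭ perm y∈)))
      (λ {z} z∈ → subst (_∈ map τ w) (transpose-involutive a c z)
        (∈-map⁺ τ (∈-resp-↭ (↭-sym perm) (transpose-∈ a c a∈ c∈ z∈))))
    a<c : Before a c (map τ w)
    a<c with Before-map⁺ τ c<a
    ... | b rewrite transpose-left a c | transpose-right a c = b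
    -- Compatibility of the exchanged word, pulled back along `τ`. If `y` is `a`, then `x` lies
    -- above `c`, and `up` covers the case that it is not above `a`; if `x` is `c`, then `y` lies
    -- below `a`, and `down` applies; if `y` is `c` or `x` is `a`, the relation composes with `c<a`.
    precedes : ∀ {y x} → y ∈ D → x ∈ D → τ y ≺ τ x → Before y x w
    precedes {y} {x} y∈ x∈ lt with y ≟ᶜ a | y ≟ᶜ c | x ≟ᶜ a | x ≟ᶜ c
    ... | yes refl | _        | yes refl | _        = contradiction refl (proj₂ lt)
    ... | yes refl | _        | no _     | yes refl = contradiction (proj₁ lt) c⋠a
    ... | yes refl | _        | no x≢a   | no _     with a ≼? x
    ...   | yes a≼x = ordered a∈ x∈ (a≼x , x≢a ∘ sym)
    ...   | no a⋠x  = up x∈ lt a⋠x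
    precedes y∈ x∈ lt | no _ | yes refl | yes refl | _        = contradiction (proj₁ lt) a⋠c
    precedes y∈ x∈ lt | no _ | yes refl | no _     | yes refl = contradiction refl (proj₂ lt)
    precedes y∈ x∈ lt | no _ | yes refl | no _     | no _     = Before-trans unique c<a (ordered a∈ x∈ lt)
    precedes y∈ x∈ lt | no _ | no _     | yes refl | _        = Before-trans unique (ordered y∈ c∈ lt) c<a
    precedes y∈ x∈ lt | no _ | no _     | no _     | yes refl = ordered y∈ c∈ (down y∈ lt)
    precedes y∈ x∈ lt | no _ | no _     | no _     | no _     = ordered y∈ x∈ lt
    compat′ : Compatible (map τ w)
    compat′ b lt with Before-map⁻ τ w b
    ... | x , y , x<y , refl , refl = Before-asym unique x<y
      (precedes (∈-resp-↭ perm (Before-∈ʳ x<y)) (∈-resp-↭ perm (Before-∈ˡ x<y)) lt)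

  not-before⇒after : ∀ {a c w} → a ∈ D → c ∈ D → ¬ a ≼ c → LinExt uD w → ¬ T (beforeᵇ a c w) → Before c a w
  not-before⇒after a∈ c∈ a⋠c le a≮c
    with Before-total (∈-resp-↭ (↭-sym (LinExt.perm le)) a∈) (∈-resp-↭ (↭-sym (LinExt.perm le)) c∈)
           (λ { refl → a⋠c ≼-refl })
  ... | inj₁ a<c = contradiction (beforeᵇ⁺ (LinExt.unique le) a<c) a≮c
  ... | inj₂ c<a = c<a

  -- The predicate `p` is left free for two uses: constantly true at the top of a ladder, and `a`
  -- before `c⁺` on a step.
  e≺-double : ∀ {a c} (p : List Cell → Bool) → a ∈ D → c ∈ D → ¬ a ≼ c → ¬ c ≼ a →
    (∀ {u} → u ∈ D → u ≺ a → u ≺ c) →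
    (∀ {v w} → LinExt uD w → T (p w) → v ∈ D → c ≺ v → ¬ a ≼ v → Before a v w) →
    length (filterᵇ p L) ≤ e≺ D a c + e≺ D a c
  e≺-double {a} {c} p a∈ c∈ a⋠c c⋠a down up =
    count-≤-double L (linearExtensions-unique uD) p (beforeᵇ a c) (map (transpose a c))
      (map-transpose-injective a c)
      λ w∈ pw a≮c → let le = ∈-linearExtensions⁻ uD w∈
                        le′ , b = exchange a∈ c∈ a⋠c c⋠a down (up le pw)
                                    (not-before⇒after a∈ c∈ a⋠c le a≮c) le
                    in ∈-linearExtensions⁺ uD le′ , beforeᵇ⁺ (LinExt.unique le′) b

  -- The cell `b` stays fixed as an anchor while `c` climbs: that `c` is not below `a`, and the
  -- inclusion of strict lower sets, are inherited from `b`. The invariant is the last inequality.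
  climb : ∀ {a b c} → a ∈ D → c ∈ D → ¬ b ≼ a → b ≼ c → ¬ a ≼ c →
    (∀ {u} → u ∈ D → u ≺ a → u ≺ b) → Ladder D a c → 3 * e≺ D a c < e D → OneThirdBalanced D
  climb {a} {b} {c} a∈ c∈ b⋠a b≼c a⋠c down ladder small = go ladder
    where
    s : ℕ
    s = e≺ D a c
    c⋠a : ¬ c ≼ a
    c⋠a c≼a = b⋠a (≼-trans b≼c c≼a)
    down′ : ∀ {u} → u ∈ D → u ≺ a → u ≺ c
    down′ u∈ u≺a with down u∈ u≺a
    ... | u≼b , _ = ≼-trans u≼b b≼c , λ { refl → c⋠a (proj₁ u≺a) }
    go : Ladder D a c → OneThirdBalanced D
    -- At the top every extension with `c` before `a` can be exchanged, so `e D ≤ s + s ≤ 3 * s`,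
    -- against `small`.
    go (top upper) = contradiction
      (≤-trans (length-⊆ (linearExtensions-unique uD) (λ w∈ → ∈-filterᵇ⁺ (λ _ → true) w∈ _))
        (≤-trans (e≺-double (λ _ → true) a∈ c∈ a⋠c c⋠a down′ λ _ _ v∈ c≺v a⋠v → contradiction (upper v∈ c≺v) a⋠v)
          (+-monoʳ-≤ s (m≤m+n s _))))
      (<⇒≱ small)
    go (step {c⁺ = c⁺} c⁺∈ c≼c⁺ a⋠c⁺ least ladder⁺) with e D ≤? 3 * e≺ D a c⁺
    ... | no  small⁺ = climb a∈ c⁺∈ b⋠a (≼-trans b≼c c≼c⁺) a⋠c⁺ down ladder⁺ (≰⇒> small⁺)
    ... | yes large  = a , c⁺ , a∈ , c⁺∈ , (λ { refl → a⋠c⁺ ≼-refl }) , large , (begin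
        3 * e≺ D a c⁺ ≤⟨ *-monoʳ-≤ 3 doubled ⟩
        3 * (s + s)   ≡⟨ cong (3 *_) (cong (s +_) (sym (+-identityʳ s))) ⟩
        3 * (2 * s)   ≡⟨ trans (sym (*-assoc 3 2 s)) (*-assoc 2 3 s) ⟩
        2 * (3 * s)   ≤⟨ *-monoʳ-≤ 2 (<⇒≤ small) ⟩
        2 * e D       ∎)
      where
      open ≤-Reasoning
      doubled : e≺ D a c⁺ ≤ s + s
      doubled = e≺-double (beforeᵇ a c⁺) a∈ c∈ a⋠c c⋠a down′ up
        where
        -- A cell strictly above `c` and not above `a` is `c⁺` or lies above it, so once `a`
        -- precedes `c⁺` it precedes all of them.
        up : ∀ {v w} → LinExt uD w → T (beforeᵇ a c⁺ w) → v ∈ D → c ≺ v → ¬ a ≼ v → Before a v w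
        up {v} {w} le t v∈ c≺v a⋠v with c⁺ ≟ᶜ v
        ... | yes refl = beforeᵇ⁻ w t
        ... | no c⁺≢v  = Before-trans (LinExt.unique le) (beforeᵇ⁻ w t)
                           (LinExt.ordered le c⁺∈ v∈ (least v∈ c≺v a⋠v , c⁺≢v))

  record AlmostTwins (a b : Cell) : Set where
    field
      a∈D    : a ∈ D
      b∈D    : b ∈ D
      a⋠b    : ¬ a ≼ b
      b⋠a    : ¬ b ≼ a
      down-a : ∀ {u} → u ∈ D → u ≺ a → u ≺ b
      down-b : ∀ {u} → u ∈ D → u ≺ b → u ≺ a
      up-a   : ChainAbove D a b
      up-b   : ChainAbove D b a

  -- If the count reaches a third of `e D`, the pair itself works, a half being at most two thirds;
  -- otherwise the climb starts at `b`.
  e≺-rare⇒balanced : ∀ {a b} → a ∈ D → b ∈ D → ¬ a ≼ b → ¬ b ≼ a →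
    (∀ {u} → u ∈ D → u ≺ a → u ≺ b) → ChainAbove D b a →
    e≺ D a b + e≺ D a b ≤ e D → OneThirdBalanced D
  e≺-rare⇒balanced {a} {b} a∈ b∈ a⋠b b⋠a down chain rare with e D ≤? 3 * e≺ D a b
  ... | no small  = climb a∈ b∈ b⋠a ≼-refl a⋠b down (chain⇒ladder uD chain) (≰⇒> small)
  ... | yes large = a , b , a∈ , b∈ , (λ { refl → a⋠b ≼-refl }) , large , (begin
      3 * s         ≤⟨ *-monoˡ-≤ s (n≤1+n 3) ⟩
      4 * s         ≡⟨ *-assoc 2 2 s ⟩
      2 * (2 * s)   ≡⟨ cong (2 *_) (cong (s +_) (+-identityʳ s)) ⟩
      2 * (s + s)   ≤⟨ *-monoʳ-≤ 2 rare ⟩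
      2 * e D       ∎)
    where
    open ≤-Reasoning
    s : ℕ
    s = e≺ D a b

  e≺-sum : ∀ a b → e≺ D a b + e≺ D b a ≤ e D
  e≺-sum a b = count-disjoint L (linearExtensions-unique uD) (beforeᵇ a b) (beforeᵇ b a)
    λ {w} w∈ t t′ → Before-asym (LinExt.unique (∈-linearExtensions⁻ uD w∈)) (beforeᵇ⁻ w t) (beforeᵇ⁻ w t′)

  almostTwins⇒balanced : ∀ {a b} → AlmostTwins a b → OneThirdBalanced D
  almostTwins⇒balanced {a} {b} twins = case ≤-total (e≺ D a b) (e≺ D b a) of λ where
      (inj₁ le) → e≺-rare⇒balanced a∈D b∈D a⋠b b⋠a down-a up-b
        (≤-trans (+-monoʳ-≤ (e≺ D a b) le) (e≺-sum a b))
      (inj₂ le) → e≺-rare⇒balanced b∈D a∈D b⋠a a⋠b down-b up-a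
        (≤-trans (+-monoʳ-≤ (e≺ D b a) le) (e≺-sum b a))
    where open AlmostTwins twins

-- Almost twins in skew shapes

-- The region in which diagrams live. Shifted shapes are order-convex only relative to it: `(2 , 1)`
-- lies between the diagonal cells `(1 , 1)` and `(2 , 2)`.
Ambient : Kind → Cell → Set
Ambient ordinary _       = ⊤
Ambient shifted  (i , j) = i ≤ j

ambient? : ∀ k x → Dec (Ambient k x)
ambient? ordinary _       = yes _
ambient? shifted  (i , j) = i ≤? j

ambient-right : ∀ k {i j} → Ambient k (i , j) → Ambient k (i , suc j)
ambient-right ordinary _ = _
ambient-right shifted  p = m≤n⇒m≤1+n p

row-comparable : ∀ {r i i′ j j′} → i ≡ r → i′ ≡ r → (i , j) ≼ (i′ , j′) ⊎ (i′ , j′) ≼ (i , j)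
row-comparable {j = j} {j′} refl refl with ≤-total j j′
... | inj₁ p = inj₁ (≤-refl , p)
... | inj₂ p = inj₂ (≤-refl , p)

column-comparable : ∀ {c i i′ j j′} → j ≡ c → j′ ≡ c → (i , j) ≼ (i′ , j′) ⊎ (i′ , j′) ≼ (i , j)
column-comparable {i = i} {i′} refl refl with ≤-total i i′
... | inj₁ p = inj₁ (p , ≤-refl)
... | inj₂ p = inj₂ (p , ≤-refl)

-- The three cells (r , r), (r , 1 + r), (1 + r , 1 + r) form a chain.
triangle-comparable : ∀ {r i i′ j j′} → r ≤ i → r ≤ i′ → i ≤ j → i′ ≤ j′ → j < 2 + r → j′ < 2 + r →
  (i , j) ≼ (i′ , j′) ⊎ (i′ , j′) ≼ (i , j)
triangle-comparable {i = i} {i′} {j} {j′} r≤i r≤i′ i≤j i′≤j′ j< j′< with ≤-total i i′ | ≤-total j j′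
... | inj₁ p | inj₁ q = inj₁ (p , q)
... | inj₂ p | inj₂ q = inj₂ (p , q)
... | inj₁ p | inj₂ q with j ≟ j′
...   | yes refl = inj₁ (p , ≤-refl)
-- Here `j′ < j ≤ 1 + r`, hence `i′ ≤ j′ ≤ r ≤ i`.
...   | no j≢j′  = inj₂ (≤-trans i′≤j′ (≤-trans (s≤s⁻¹ (<-≤-trans (≤∧≢⇒< q (j≢j′ ∘ sym)) (s≤s⁻¹ j<))) r≤i) , q)
triangle-comparable {i = i} {i′} {j} {j′} r≤i r≤i′ i≤j i′≤j′ j< j′< | inj₂ p | inj₁ q with j ≟ j′
...   | yes refl = inj₂ (p , ≤-refl)
...   | no j≢j′  = inj₁ (≤-trans i≤j (≤-trans (s≤s⁻¹ (<-≤-trans (≤∧≢⇒< q j≢j′) (s≤s⁻¹ j′<))) r≤i′) , q)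

module ConvexShape
  (k : Kind) {D : List Cell} (uD : Unique D)
  (ambient : ∀ {x} → x ∈ D → Ambient k x)
  (convex : ∀ {x y z} → x ∈ D → y ∈ D → x ≼ z → z ≼ y → Ambient k z → z ∈ D)
  (¬chain : ¬ IsChain D)
  where

  _∈D? : ∀ x → Dec (x ∈ D)
  x ∈D? = Any.any? (x ≟ᶜ_) D

  Twins : Set
  Twins = ∃[ a ] ∃[ b ] AlmostTwins uD a b

  -- The minimal cell visited just before `(r , c)`. The field `chain` is the half of the
  -- almost-twin condition for these two cells that was established when the search moved on.
  record Previous (r c : ℕ) : Set where
    field
      {r′ c′} : ℕ
      ∈D      : (r′ , c′) ∈ D
      r′<r    : r′ < r
      c<c′    : c < c′
      right   : ∀ {i j} → (i , j) ∈ D → i < r → c′ ≤ j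
      minimal : ∀ {u} → u ∈ D → ¬ u ≺ (r′ , c′)
      chain   : ChainAbove D (r′ , c′) (r , c)

  -- Minimal cells are visited from the north-east to the south-west; (r , c) is the current one.
  record Front (r c : ℕ) : Set where
    field
      ∈D   : (r , c) ∈ D
      left : ∀ {j} → (r , j) ∈ D → c ≤ j
      prev : (∀ {i j} → (i , j) ∈ D → r ≤ i) ⊎ Previous r c

    minimal : ∀ {u} → u ∈ D → ¬ u ≺ (r , c)
    minimal {i , j} u∈ ((i≤r , j≤c) , u≢) with i ≟ r
    ... | yes refl = u≢ (cong (i ,_) (≤-antisym j≤c (left u∈)))
    ... | no i≢r with prev
    ...   | inj₁ first = i≢r (≤-antisym i≤r (first u∈))
    ...   | inj₂ pr    = <⇒≱ (<-≤-trans (Previous.c<c′ pr) (Previous.right pr u∈ (≤∧≢⇒< i≤r i≢r))) j≤c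

    above-or-left : ∀ {i j} → (i , j) ∈ D → j < c → r < i
    above-or-left {i} {j} u∈ j<c with <-cmp r i
    ... | tri< r<i _ _  = r<i
    ... | tri≈ _ refl _ = contradiction (left u∈) (<⇒≱ j<c)
    ... | tri> _ _ i<r with prev
    ...   | inj₁ first = contradiction (first u∈) (<⇒≱ i<r)
    ...   | inj₂ pr    = contradiction (<-≤-trans (Previous.c<c′ pr) (Previous.right pr u∈ i<r)) (<-asym j<c)

  -- Both cells are minimal, so the conditions on lower sets are vacuous, and one chain condition is
  -- already stored in `pr`.
  twins-previous : ∀ {r c} → Front r c → (pr : Previous r c) →
    ChainAbove D (r , c) (Previous.r′ pr , Previous.c′ pr) → Twins
  twins-previous front pr chain′ = _ , _ , record
    { a∈D    = Previous.∈D pr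
    ; b∈D    = Front.∈D front
    ; a⋠b    = λ (_ , q) → <⇒≱ (Previous.c<c′ pr) q
    ; b⋠a    = λ (p , _) → <⇒≱ (Previous.r′<r pr) p
    ; down-a = λ u∈ u≺ → contradiction u≺ (Previous.minimal pr u∈)
    ; down-b = λ u∈ u≺ → contradiction u≺ (Front.minimal front u∈)
    ; up-a   = Previous.chain pr
    ; up-b   = chain′
    }

  ComparableAbove : Cell → (Cell → Set) → Set
  ComparableAbove p P = ∀ {u v} → u ∈ D → v ∈ D → p ≼ u → p ≼ v → P u → P v → u ≼ v ⊎ v ≼ u

  -- Cells above `(r , c)` but not above the previous minimal cell have column below `c′`. If
  -- `c′ ≤ m` they form a chain, giving twins; otherwise the rows north of `r` start beyond column
  -- `m`, so they cannot disturb lower sets there.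
  clear : ∀ {r c} m → Front r c → ComparableAbove (r , c) (λ (_ , j) → j < m) →
    Twins ⊎ (∀ {i j} → (i , j) ∈ D → j ≤ m → r ≤ i)
  clear {r} {c} m front comparable with Front.prev front
  ... | inj₁ first = inj₂ λ u∈ _ → first u∈
  ... | inj₂ pr with Previous.c′ pr ≤? m
  ...   | yes c′≤m = inj₁ (twins-previous front pr λ u∈ v∈ p≼u p≼v p′⋠u p′⋠v →
            comparable u∈ v∈ p≼u p≼v (narrow p≼u p′⋠u) (narrow p≼v p′⋠v))
    where
    narrow : ∀ {u} → (r , c) ≼ u → ¬ (Previous.r′ pr , Previous.c′ pr) ≼ u → proj₂ u < m
    narrow (r≤i , _) p′⋠u = <-≤-trans (≰⇒> λ c′≤j → p′⋠u (≤-trans (<⇒≤ (Previous.r′<r pr)) r≤i , c′≤j)) c′≤m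
  ...   | no c′≰m = inj₂ λ u∈ j≤m → ≮⇒≥ λ i<r → c′≰m (≤-trans (Previous.right pr u∈ i<r) j≤m)

  data Next (r c : ℕ) : Set where
    none : (∀ {i j} → (i , j) ∈ D → c ≤ j) → Next r c
    some : ∀ {i j} → r < i → j < c →
      (∀ {j′} → (i , j′) ∈ D → j ≤ j′) → (i , j) ∈ D →
      (∀ {i′ j′} → (i′ , j′) ∈ D → i′ < i → c ≤ j′) → Next r c

  -- The reading-order minimum of the cells west of column `c` is the leftmost cell of the first row
  -- that has any.
  next : ∀ {r c} → Front r c → Next r c
  next {r} {c} front with filter (λ (_ , j) → j <? c) D in eq
  ... | [] = none λ {i} {j} u∈ → ≮⇒≥ λ j<c →
          case subst ((i , j) ∈_) eq (∈-filter⁺ (λ (_ , j) → j <? c) u∈ j<c) of λ ()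
  ... | x ∷ xs with lexMin x xs
  ...   | (i , j) , q∈ , min with ∈-filter⁻ (λ (_ , j) → j <? c) {xs = D} (subst ((i , j) ∈_) (sym eq) q∈)
  ...     | q∈D , j<c = some (Front.above-or-left front q∈D j<c) j<c left q∈D right
    where
    least : ∀ {u} → u ∈ D → proj₂ u < c → (i , j) ≤ₗ u
    least {u} u∈ lt = min (subst (u ∈_) eq (∈-filter⁺ (λ (_ , j) → j <? c) u∈ lt))
    left : ∀ {j′} → (i , j′) ∈ D → j ≤ j′
    left {j′} u∈ with j′ <? c
    ... | no j′≮c = ≤-trans (<⇒≤ j<c) (≮⇒≥ j′≮c)
    ... | yes lt with least u∈ lt
    ...   | inj₁ i<i       = contradiction i<i (n≮n i)
    ...   | inj₂ (_ , j≤j′) = j≤j′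
    right : ∀ {i′ j′} → (i′ , j′) ∈ D → i′ < i → c ≤ j′
    right u∈ i′<i = ≮⇒≥ λ lt → case least u∈ lt of λ where
      (inj₁ i<i′)       → <-asym i′<i i<i′
      (inj₂ (refl , _)) → n≮n _ i′<i

  -- Since `j < c`, a cell above `(r , c)` can miss being above `(i , j)` only by lying in a row
  -- before `i`.
  advance : ∀ {r c i j} → Front r c → r < i → j < c →
    (∀ {j′} → (i , j′) ∈ D → j ≤ j′) → (i , j) ∈ D →
    (∀ {i′ j′} → (i′ , j′) ∈ D → i′ < i → c ≤ j′) →
    ComparableAbove (r , c) (λ (i′ , _) → i′ < i) → Front i j
  advance front r<i j<c left q∈ right comparable = record
    { ∈D   = q∈
    ; left = left
    ; prev = inj₂ record
      { ∈D      = Front.∈D front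
      ; r′<r    = r<i
      ; c<c′    = j<c
      ; right   = right
      ; minimal = Front.minimal front
      ; chain   = λ u∈ v∈ p≼u p≼v q⋠u q⋠v → comparable u∈ v∈ p≼u p≼v (higher p≼u q⋠u) (higher p≼v q⋠v)
      }
    }
    where
    higher : ∀ {u} → _ ≼ u → ¬ (_ , _) ≼ u → proj₁ u < _
    higher (_ , c≤) q⋠u = ≰⇒> λ i≤ → q⋠u (i≤ , ≤-trans (<⇒≤ j<c) c≤)

  -- Cells above `(r , c)` in columns below `suc c` lie in column `c`, so `clear` applies. With the
  -- north cleared and nothing west of `c` in row `suc r`, both twins have `(r , c)` as their only
  -- strictly smaller cell.
  square-twins : ∀ {r c} → Front r c → (r , suc c) ∈ D → (suc r , c) ∈ D →
    (∀ {j} → (suc r , j) ∈ D → c ≤ j) → Twins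
  square-twins {r} {c} front a∈ b∈ left′ with clear (suc c) front
    (λ _ _ (_ , c≤) (_ , c≤′) j< j′< → column-comparable (≤-antisym (s≤s⁻¹ j<) c≤) (≤-antisym (s≤s⁻¹ j′<) c≤′))
  ... | inj₁ twins = twins
  ... | inj₂ below = (r , suc c) , (suc r , c) , record
    { a∈D    = a∈
    ; b∈D    = b∈
    ; a⋠b    = λ (_ , q) → 1+n≰n q
    ; b⋠a    = λ (p , _) → 1+n≰n p
    ; down-a = down-a
    ; down-b = down-b
    ; up-a   = λ _ _ p≼u p≼v b⋠u b⋠v → row-comparable (in-row p≼u b⋠u) (in-row p≼v b⋠v)
    ; up-b   = λ _ _ p≼u p≼v a⋠u a⋠v → column-comparable (in-column p≼u a⋠u) (in-column p≼v a⋠v)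
    }
    where
    down-a : ∀ {u} → u ∈ D → u ≺ (r , suc c) → u ≺ (suc r , c)
    down-a {i , j} u∈ ((i≤r , j≤) , u≢) with ≤-antisym i≤r (below u∈ j≤)
    ... | refl = (n≤1+n r , s≤s⁻¹ (≤∧≢⇒< j≤ λ { refl → u≢ refl })) , λ ()
    down-b : ∀ {u} → u ∈ D → u ≺ (suc r , c) → u ≺ (r , suc c)
    down-b {i , j} u∈ ((i≤ , j≤c) , u≢) =
      (s≤s⁻¹ (≤∧≢⇒< i≤ λ { refl → u≢ (cong (suc r ,_) (≤-antisym j≤c (left′ u∈))) }) , m≤n⇒m≤1+n j≤c)
      , λ { refl → 1+n≰n j≤c }
    in-row : ∀ {u} → (r , suc c) ≼ u → ¬ (suc r , c) ≼ u → proj₁ u ≡ r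
    in-row (r≤ , c<) b⋠u = ≤-antisym (s≤s⁻¹ (≰⇒> λ r< → b⋠u (r< , <⇒≤ c<))) r≤
    in-column : ∀ {u} → (suc r , c) ≼ u → ¬ (r , suc c) ≼ u → proj₂ u ≡ c
    in-column (r< , c≤) a⋠u = ≤-antisym (s≤s⁻¹ (≰⇒> λ c< → a⋠u (<⇒≤ r< , c<))) c≤

  -- On the diagonal there is no cell `(1 + r , r)`, so the fork occurs one step later, above
  -- `(r , 1 + r)`. The cells that `clear` has to compare lie in a triangle, which is a chain.
  diagonal-twins : ∀ {r} → Front r r → (∀ {i j} → (i , j) ∈ D → i ≤ j) →
    (r , 2 + r) ∈ D → (1 + r , 1 + r) ∈ D → Twins
  diagonal-twins {r} front i≤j a∈ b∈ with clear (2 + r) front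
    (λ u∈ v∈ (r≤ , _) (r≤′ , _) → triangle-comparable r≤ r≤′ (i≤j u∈) (i≤j v∈))
  ... | inj₁ twins = twins
  ... | inj₂ below = (r , 2 + r) , (1 + r , 1 + r) , record
    { a∈D    = a∈
    ; b∈D    = b∈
    ; a⋠b    = λ (_ , q) → 1+n≰n q
    ; b⋠a    = λ (p , _) → 1+n≰n p
    ; down-a = down-a
    ; down-b = down-b
    ; up-a   = λ _ _ p≼u p≼v b⋠u b⋠v → row-comparable (in-row p≼u b⋠u) (in-row p≼v b⋠v)
    ; up-b   = λ _ _ p≼u p≼v a⋠u a⋠v → column-comparable (in-column p≼u a⋠u) (in-column p≼v a⋠v)
    }
    where
    down-a : ∀ {u} → u ∈ D → u ≺ (r , 2 + r) → u ≺ (1 + r , 1 + r)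
    down-a {i , j} u∈ ((i≤r , j≤) , u≢) with ≤-antisym i≤r (below u∈ j≤)
    ... | refl = (n≤1+n r , s≤s⁻¹ (≤∧≢⇒< j≤ λ { refl → u≢ refl })) , λ ()
    down-b : ∀ {u} → u ∈ D → u ≺ (1 + r , 1 + r) → u ≺ (r , 2 + r)
    down-b {i , j} u∈ ((i≤ , j≤) , u≢) =
      (s≤s⁻¹ (≤∧≢⇒< i≤ λ { refl → u≢ (cong (suc r ,_) (≤-antisym j≤ (i≤j u∈))) }) , m≤n⇒m≤1+n j≤)
      , λ { refl → 1+n≰n j≤ }
    in-row : ∀ {u} → (r , 2 + r) ≼ u → ¬ (1 + r , 1 + r) ≼ u → proj₁ u ≡ r
    in-row (r≤ , c<) b⋠u = ≤-antisym (s≤s⁻¹ (≰⇒> λ r< → b⋠u (r< , <⇒≤ c<))) r≤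
    in-column : ∀ {u} → (1 + r , 1 + r) ≼ u → ¬ (r , 2 + r) ≼ u → proj₂ u ≡ 1 + r
    in-column (r< , c≤) a⋠u = ≤-antisym (s≤s⁻¹ (≰⇒> λ c< → a⋠u (<⇒≤ r< , c<))) c≤

  mutual

    -- The column bound `n` is fuel: every new minimal cell lies strictly further west. If a
    -- neighbour of `(r , c)` is missing, convexity forces the cells above `(r , c)` into a chain.
    twins-from : ∀ n {r c} → c ≤ n → Front r c → Twins
    twins-from n {r} {c} c≤n front with (r , suc c) ∈D? | ambient? k (suc r , c)
    ... | no a∉ | _ = twins-from-chain n c≤n front λ {u} {v} u∈ v∈ p≼u p≼v →
            column-comparable (in-column u∈ p≼u) (in-column v∈ p≼v)
      where
      in-column : ∀ {u} → u ∈ D → (r , c) ≼ u → proj₂ u ≡ c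
      in-column u∈ (r≤ , c≤) = ≤-antisym (≮⇒≥ λ c< → a∉
        (convex ∈D u∈ (≤-refl , n≤1+n c) (r≤ , c<) (ambient-right k (ambient ∈D)))) c≤
        where open Front front
    ... | yes a∈ | yes amb with (suc r , c) ∈D?
    ...   | no b∉ = twins-from-chain n c≤n front λ {u} {v} u∈ v∈ p≼u p≼v →
            row-comparable (in-row u∈ p≼u) (in-row v∈ p≼v)
      where
      in-row : ∀ {u} → u ∈ D → (r , c) ≼ u → proj₁ u ≡ r
      in-row u∈ (r≤ , c≤) = ≤-antisym (≮⇒≥ λ r< → b∉
        (convex (Front.∈D front) u∈ (n≤1+n r , ≤-refl) (r< , c≤) amb)) r≤
    ...   | yes b∈ with next front
    ...     | none right = square-twins front a∈ b∈ right
    ...     | some {i} {j} r<i j<c left q∈ right with i ≟ suc r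
    -- The next minimal cell is below `(suc r , c)` but not below `(r , suc c)`, which spoils the
    -- square. The cells above `(r , c)` and not above it lie in row `r`, so the search can move on.
    ...       | yes refl = twins-below n c≤n j<c (advance front r<i j<c left q∈ right
                  λ _ _ (r≤ , _) (r≤′ , _) i< i<′ →
                    row-comparable (≤-antisym (s≤s⁻¹ i<) r≤) (≤-antisym (s≤s⁻¹ i<′) r≤′))
    ...       | no i≢    = square-twins front a∈ b∈ λ u∈ → right u∈ (≤∧≢⇒< r<i (i≢ ∘ sym))
    twins-from n {r} {c} c≤n front | yes a∈ | no ¬amb = diagonal k refl
      where
      open Front front
      -- The module parameter `k` is split through an equation. In the shifted case, `(suc r , c)`
      -- lying outside the region forces `c ≡ r`.
      diagonal : ∀ k′ → k ≡ k′ → Twins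
      diagonal ordinary refl = contradiction _ ¬amb
      diagonal shifted  refl with ≤-antisym (ambient ∈D) (≮⇒≥ ¬amb)
      ... | refl with (1 + r , 1 + r) ∈D?
      ...   | no b∉ = twins-from-chain n c≤n front λ {u} {v} u∈ v∈ p≼u p≼v →
              row-comparable (in-row u∈ p≼u) (in-row v∈ p≼v)
        where
        in-row : ∀ {u} → u ∈ D → (r , r) ≼ u → proj₁ u ≡ r
        in-row u∈ (r≤ , _) = ≤-antisym (≮⇒≥ λ r< → b∉
          (convex ∈D u∈ (n≤1+n r , n≤1+n r) (r< , ≤-trans r< (ambient u∈)) ≤-refl)) r≤
      ...   | yes b∈ with (r , 2 + r) ∈D?
      ...     | yes a′∈ = diagonal-twins front ambient a′∈ b∈
      -- Without `(r , 2 + r)`, convexity confines the cells above `(r , r)` to columns `r` and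
      -- `1 + r`.
      ...     | no a′∉  = twins-from-chain n c≤n front λ {u} {v} u∈ v∈ p≼u p≼v →
                triangle-comparable (proj₁ p≼u) (proj₁ p≼v) (ambient u∈) (ambient v∈)
                  (narrow u∈ p≼u) (narrow v∈ p≼v)
        where
        narrow : ∀ {u} → u ∈ D → (r , r) ≼ u → proj₂ u < 2 + r
        narrow u∈ (r≤ , _) = ≰⇒> λ r< → a′∉
          (convex ∈D u∈ (≤-refl , m≤n+m r 2) (r≤ , r<) (m≤n+m r 2))

    twins-below : ∀ n {r c c′} → c′ ≤ n → c < c′ → Front r c → Twins
    twins-below zero    z≤n ()
    twins-below (suc n) c′≤n c<c′ front = twins-from n (s≤s⁻¹ (≤-trans c<c′ c′≤n)) front

    twins-from-chain : ∀ n {r c} → c ≤ n → Front r c →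
      (∀ {u v} → u ∈ D → v ∈ D → (r , c) ≼ u → (r , c) ≼ v → u ≼ v ⊎ v ≼ u) → Twins
    twins-from-chain n {r} {c} c≤n front comparable with Front.prev front
    ... | inj₂ pr = twins-previous front pr λ u∈ v∈ p≼u p≼v _ _ → comparable u∈ v∈ p≼u p≼v
    ... | inj₁ first with next front
    -- With neither predecessor nor successor, `(r , c)` is the least cell, so the chain above it is
    -- all of `D`.
    ...   | none right = ⊥-elim (¬chain λ u v u∈ v∈ →
              comparable u∈ v∈ (first u∈ , right u∈) (first v∈ , right v∈))
    ...   | some r<i j<c left q∈ right = twins-below n c≤n j<c
              (advance front r<i j<c left q∈ right λ u∈ v∈ p≼u p≼v _ _ → comparable u∈ v∈ p≼u p≼v)

  -- The search starts at the leftmost cell of the first nonempty row, with its column as fuel.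
  twins : Twins
  twins = start D refl
    where
    start : ∀ xs → D ≡ xs → Twins
    start []       refl = ⊥-elim (¬chain λ _ _ ())
    start (x ∷ xs) refl with lexMin x xs
    ... | (r , c) , p∈ , min = twins-from c ≤-refl record
      { ∈D   = p∈
      ; left = λ u∈ → case min u∈ of λ where
          (inj₁ r<r)      → contradiction r<r (n≮n r)
          (inj₂ (_ , c≤)) → c≤
      ; prev = inj₁ λ u∈ → case min u∈ of λ where
          (inj₁ r<)         → <⇒≤ r<
          (inj₂ (refl , _)) → ≤-refl
      }

-- Diagrams

∈-rowCells⁻ : ∀ {i s} n {i′ j′} → (i′ , j′) ∈ rowCells i s n → i′ ≡ i × s ≤ j′ × j′ < s + n
∈-rowCells⁻ {i} {s} (suc n) (here refl) = refl , ≤-refl , m<m+n s z<s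
∈-rowCells⁻ {i} {s} (suc n) (there x∈) with ∈-rowCells⁻ n x∈
... | eq , s< , j< = eq , <⇒≤ s< , ≤-trans j< (≤-reflexive (sym (+-suc s n)))

∈-rowCells⁺ : ∀ {i s} n {j} → s ≤ j → j < s + n → (i , j) ∈ rowCells i s n
∈-rowCells⁺ {s = s} zero    s≤j j< = contradiction (<-≤-trans j< (≤-reflexive (+-identityʳ s))) (≤⇒≯ s≤j)
∈-rowCells⁺ {s = s} (suc n) {j} s≤j j< with s ≟ j
... | yes refl = here refl
... | no s≢j   = there (∈-rowCells⁺ n (≤∧≢⇒< s≤j s≢j) (≤-trans j< (≤-reflexive (+-suc s n))))

rowCells-unique : ∀ i s n → Unique (rowCells i s n)
rowCells-unique i s zero    = []
rowCells-unique i s (suc n) =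
  All.tabulate (λ x∈ → λ { refl → n≮n s (proj₁ (proj₂ (∈-rowCells⁻ n x∈))) })
  ∷ rowCells-unique i (suc s) n

diagramFrom-row : ∀ k {i} l {i′ j′} → (i′ , j′) ∈ diagramFrom k i l → i ≤ i′
diagramFrom-row k {i} (a ∷ as) x∈ with ∈-++⁻ (rowCells i (rowStart k i) a) x∈
... | inj₁ x∈r with ∈-rowCells⁻ a x∈r
...   | refl , _ = ≤-refl
diagramFrom-row k {i} (a ∷ as) x∈ | inj₂ x∈d = <⇒≤ (diagramFrom-row k as x∈d)

diagramFrom-column : ∀ k {i} l {i′ j′} → (i′ , j′) ∈ diagramFrom k i l → rowStart k i′ ≤ j′
diagramFrom-column k {i} (a ∷ as) x∈ with ∈-++⁻ (rowCells i (rowStart k i) a) x∈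
... | inj₁ x∈r with ∈-rowCells⁻ a x∈r
...   | refl , s≤ , _ = s≤
diagramFrom-column k {i} (a ∷ as) x∈ | inj₂ x∈d = diagramFrom-column k as x∈d

diagramFrom-unique : ∀ k i l → Unique (diagramFrom k i l)
diagramFrom-unique k i []       = []
diagramFrom-unique k i (a ∷ as) =
  Unique.++⁺ (rowCells-unique i (rowStart k i) a) (diagramFrom-unique k (suc i) as) disjoint
  where
  disjoint : Disjoint (rowCells i (rowStart k i) a) (diagramFrom k (suc i) as)
  disjoint (x∈r , x∈d) with ∈-rowCells⁻ a x∈r
  ... | refl , _ = 1+n≰n (diagramFrom-row k as x∈d)

Decreasing : Kind → List ℕ → Set
Decreasing ordinary = Linked (λ a b → b ≤ a)
Decreasing shifted  = Linked (λ a b → b < a)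

decreasing-tail : ∀ k {a as} → Decreasing k (a ∷ as) → Decreasing k as
decreasing-tail ordinary [-]      = []
decreasing-tail ordinary (_ ∷ ds) = ds
decreasing-tail shifted  [-]      = []
decreasing-tail shifted  (_ ∷ ds) = ds

-- In the shifted case, strictness of the partition pays for each row starting one column later.
rowEnd-antitone : ∀ k i {a b as} → Decreasing k (a ∷ b ∷ as) → rowStart k (suc i) + b ≤ rowStart k i + a
rowEnd-antitone ordinary i (b≤a ∷ _) = s≤s b≤a
rowEnd-antitone shifted  i {a} {b} (b<a ∷ _) =
  ≤-trans (≤-reflexive (sym (+-suc i b))) (+-monoʳ-≤ i b<a)

column-<-rowEnd : ∀ k i a as → Decreasing k (a ∷ as) → ∀ {i′ j′} →
  (i′ , j′) ∈ diagramFrom k i (a ∷ as) → j′ < rowStart k i + a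
column-<-rowEnd k i a as dec x∈ with ∈-++⁻ (rowCells i (rowStart k i) a) x∈
... | inj₁ x∈r = proj₂ (proj₂ (∈-rowCells⁻ a x∈r))
column-<-rowEnd k i a (b ∷ as) dec x∈ | inj₂ x∈d =
  <-≤-trans (column-<-rowEnd k (suc i) b as (decreasing-tail k dec) x∈d) (rowEnd-antitone k i dec)

-- The cell `y` lies in row `i′` or later, and row ends weakly decrease, so its column, hence `j′`,
-- stays before the end of row `i′`.
diagramFrom-lower : ∀ k i l → Decreasing k l → ∀ {i′ j′ y} → y ∈ diagramFrom k i l →
  (i′ , j′) ≼ y → i ≤ i′ → rowStart k i′ ≤ j′ → (i′ , j′) ∈ diagramFrom k i l
diagramFrom-lower k i (a ∷ as) dec {i′} {j′} y∈ (i′≤ , j′≤) i≤i′ s≤j′ with i ≟ i′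
... | yes refl = ∈-++⁺ˡ (∈-rowCells⁺ a s≤j′ (≤-<-trans j′≤ (column-<-rowEnd k i a as dec y∈)))
... | no i≢i′ with ∈-++⁻ (rowCells i (rowStart k i) a) y∈
...   | inj₂ y∈d = ∈-++⁺ʳ (rowCells i (rowStart k i) a)
        (diagramFrom-lower k (suc i) as (decreasing-tail k dec) y∈d (i′≤ , j′≤) (≤∧≢⇒< i≤i′ i≢i′) s≤j′)
...   | inj₁ y∈r with ∈-rowCells⁻ a y∈r
...     | refl , _ = contradiction (≤-antisym i≤i′ i′≤) i≢i′

valid⇒decreasing : ∀ k {la mu} → ValidShape k la mu → Decreasing k la × Decreasing k mu
valid⇒decreasing ordinary ((_ , dla) , (_ , dmu)) = dla , dmu
valid⇒decreasing shifted  ((_ , dla) , (_ , dmu)) = dla , dmu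

module _ (k : Kind) (la mu : List ℕ) where

  private
    outside : Cell → Bool
    outside c = not (memᵇ c (diagram k mu))

  ∈-skewDiagram⁻ : ∀ {x} → x ∈ skewDiagram k la mu → x ∈ diagram k la × x ∉ diagram k mu
  ∈-skewDiagram⁻ x∈ with ∈-filterᵇ⁻ outside (diagram k la) x∈
  ... | x∈la , out = x∈la , T-not⁻ out ∘ memᵇ⁺

  ∈-skewDiagram⁺ : ∀ {x} → x ∈ diagram k la → x ∉ diagram k mu → x ∈ skewDiagram k la mu
  ∈-skewDiagram⁺ x∈la x∉mu = ∈-filterᵇ⁺ outside x∈la (T-not⁺ (x∉mu ∘ memᵇ⁻))

  skewDiagram-unique : Unique (skewDiagram k la mu)
  skewDiagram-unique = filterᵇ-unique outside (diagramFrom-unique k 1 la)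

  skewDiagram-ambient : ∀ {x} → x ∈ skewDiagram k la mu → Ambient k x
  skewDiagram-ambient x∈ = ambient k (diagramFrom-column k la (proj₁ (∈-skewDiagram⁻ x∈)))
    where
    ambient : ∀ k {i j} → rowStart k i ≤ j → Ambient k (i , j)
    ambient ordinary _  = _
    ambient shifted i≤j = i≤j

  -- Both diagrams are lower sets in the region: `z` inherits membership in `la` from `y`, and `z`
  -- in `mu` would put `x` in `mu`.
  skewDiagram-convex : ValidShape k la mu → ∀ {x y z} →
    x ∈ skewDiagram k la mu → y ∈ skewDiagram k la mu → x ≼ z → z ≼ y → Ambient k z →
    z ∈ skewDiagram k la mu
  skewDiagram-convex valid x∈ y∈ x≼z@(i≤ , j≤) z≼y amb
    with ∈-skewDiagram⁻ x∈ | ∈-skewDiagram⁻ y∈ | valid⇒decreasing k valid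
  ... | x∈la , x∉mu | y∈la , _ | dla , dmu = ∈-skewDiagram⁺
    (diagramFrom-lower k 1 la dla y∈la z≼y (≤-trans (diagramFrom-row k la x∈la) i≤)
      (start k amb (≤-trans (diagramFrom-column k la x∈la) j≤)))
    λ z∈mu → x∉mu (diagramFrom-lower k 1 mu dmu z∈mu x≼z
      (diagramFrom-row k la x∈la) (diagramFrom-column k la x∈la))
    where
    start : ∀ k {i i′ j} → Ambient k (i , j) → rowStart k i′ ≤ j → rowStart k i ≤ j
    start ordinary _ 1≤j = 1≤j
    start shifted  i≤j _ = i≤j

theorem4p1 : (k : Kind) (la mu : List ℕ) → ValidShape k la mu → mu ⊆ₚ la →
    ¬ IsChain (skewDiagram k la mu) → OneThirdBalanced (skewDiagram k la mu)
theorem4p1 k la mu valid _ ¬chain = almostTwins⇒balanced unique (proj₂ (proj₂ twins))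
  where
  unique : Unique (skewDiagram k la mu)
  unique = skewDiagram-unique k la mu
  open ConvexShape k unique (skewDiagram-ambient k la mu) (skewDiagram-convex k la mu valid) ¬chain
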